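{- Let $G$ be a Polish group, and let $\mathrm{Aut}(G)$ be the group of bicontinuous automorphisms of $G$. Suppose that $\mathcal{W}(G)$ is a countable basis for the topology of $G$ that is invariant under the natural action of $\mathrm{Aut}(G)$ on the open subsets of $G$, and that the range of the induced monomorphism $\mathrm{Aut}(G)\to\mathrm{Sym}(\mathcal{W}(G))$, $\Phi\mapsto(A\mapsto\Phi(A))$, is closed. Let $\tau$ be the topology on $\mathrm{Aut}(G)$ that makes this monomorphism a homeomorphism onto its range; thus, the subgroups of the form $\{\Phi\in\mathrm{Aut}(G): \Phi(A_i)=A_i \text{ for all } i=1,\dots,n\}$, where $A_1,\dots,A_n\in\mathcal{W}(G)$, form a neighbourhood basis of the identity consisting of open subgroups. Then $(\mathrm{Aut}(G),\tau)$ is a Polish group and the action $\mathrm{Aut}(G)\times G\to G$ is continuous.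
   Context: For a countable set $X$, $\mathrm{Sym}(X)$ is the group of permutations of $X$, which is a Polish group with the topology of pointwise convergence: the pointwise stabilisers of finite subsets of $X$ form a neighbourhood basis of the identity. -}

module Defs where

open import Level using (Level; _⊔_) renaming (suc to lsuc)
open import Algebra.Bundles using (Group)
open import Algebra.Morphism.Structures using (IsGroupHomomorphism)
import Algebra.Morphism.Construct.Composition as HomComposition
import Algebra.Morphism.Construct.Identity as HomIdentity
open import Data.List.Base using (List; []; _∷_; _++_)
open import Data.List.Relation.Unary.All as All using (All; []; _∷_)
import Data.List.Relation.Unary.All.Properties as All
open import Data.Nat.Base as ℕ using (ℕ)
open import Data.Product.Base using (Σ; ∃; _×_; _,_; proj₁; proj₂)
open import Data.Product.Relation.Binary.Pointwise.NonDependent using (×-setoid)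
open import Data.Rational.Base as ℚ using (ℚ; 0ℚ)
import Data.Rational.Properties as ℚ
open import Data.Unit.Polymorphic.Base using (⊤)
open import Function.Base using (id; _∘_; case_of_)
open import Function.Bundles using (Func; Inverse; Injection; _⇔_; mk⇔; module Equivalence)
import Function.Properties.Inverse as Inv
open import Function.Metric.Structures using (IsGeneralMetric)
open import Relation.Binary.Bundles using (Setoid)
import Relation.Binary.Construct.On as On
open import Relation.Binary.Definitions using (_Respects_; tri<; tri≈; tri>)
import Relation.Binary.PropositionalEquality as ≡
open import Relation.Nullary using (¬_; contradiction)
import Relation.Unary as Unary

private
  variable
    c c′ ℓ ℓ′ o o′ p : Level

------------------------------------------------------------------------
-- Real numbers

-- Dedekind cuts, each real being represented by the set of rationals
-- strictly below it.  The theorem is stated under excluded middle, so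
-- one-sided cuts give the usual real line.

record ℝ : Set₁ where
  field
    Below     : ℚ → Set
    inhabited : ∃ λ q → Below q
    proper    : ∃ λ q → ¬ Below q
    down      : ∀ {q r} → Below r → q ℚ.< r → Below q
    rounded   : ∀ {q} → Below q → ∃ λ r → q ℚ.< r × Below r

module Real where

  open ℝ

  infix 4 _≤_ _≈_ _<_
  infixl 6 _+_

  _≤_ : ℝ → ℝ → Set
  x ≤ y = ∀ q → Below x q → Below y q

  _≈_ : ℝ → ℝ → Set
  x ≈ y = x ≤ y × y ≤ x

  _<_ : ℝ → ℝ → Set
  x < y = ∃ λ q → ¬ Below x q × Below y q

  fromℚ : ℚ → ℝ
  fromℚ p = record
    { Below     = λ q → q ℚ.< p
    ; inhabited = p ℚ.- ℚ.1ℚ , ≡.subst (p ℚ.- ℚ.1ℚ ℚ.<_) (ℚ.+-identityʳ p)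
                                  (ℚ.+-monoʳ-< p (ℚ.negative⁻¹ (ℚ.- ℚ.1ℚ)))
    ; proper    = p , ℚ.<-irrefl ≡.refl
    ; down      = λ r<p q<r → ℚ.<-trans q<r r<p
    ; rounded   = λ q<p → case ℚ.<-dense q<p of λ where
                    (m , q<m , m<p) → m , q<m , m<p
    }

  0ℝ : ℝ
  0ℝ = fromℚ 0ℚ

  private
    below<notBelow : ∀ x {q r} → Below x q → ¬ Below x r → q ℚ.< r
    below<notBelow x {q} {r} q∈x r∉x with ℚ.<-cmp q r
    ... | tri< q<r _ _    = q<r
    ... | tri≈ _ ≡.refl _ = contradiction q∈x r∉x
    ... | tri> _ _ r<q    = contradiction (down x q∈x r<q) r∉x

    cancel : ∀ q s → (q ℚ.- s) ℚ.+ s ≡.≡ q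
    cancel q s = ≡.trans (ℚ.+-assoc q (ℚ.- s) s)
                 (≡.trans (≡.cong (q ℚ.+_) (ℚ.+-inverseˡ s)) (ℚ.+-identityʳ q))

    cancel′ : ∀ r s → (r ℚ.+ s) ℚ.- s ≡.≡ r
    cancel′ r s = ≡.trans (ℚ.+-assoc r s (ℚ.- s))
                  (≡.trans (≡.cong (r ℚ.+_) (ℚ.+-inverseʳ s)) (ℚ.+-identityʳ r))

  _+_ : ℝ → ℝ → ℝ
  x + y = record
    { Below     = λ q → ∃ λ r → ∃ λ s → Below x r × Below y s × q ≡.≡ r ℚ.+ s
    ; inhabited = case (inhabited x , inhabited y) of λ where
        ((r , r∈x) , (s , s∈y)) → r ℚ.+ s , r , s , r∈x , s∈y , ≡.refl
    ; proper    = case (proper x , proper y) of λ where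
        ((u , u∉x) , (v , v∉y)) → u ℚ.+ v , λ where
          (r , s , r∈x , s∈y , eq) → ℚ.<-irrefl (≡.sym eq)
            (ℚ.+-mono-< (below<notBelow x r∈x u∉x) (below<notBelow y s∈y v∉y))
    ; down      = λ { {q} (r , s , r∈x , s∈y , ≡.refl) q<r+s →
          q ℚ.- s , s
          , down x r∈x (≡.subst (q ℚ.- s ℚ.<_) (cancel′ r s)
                          (ℚ.+-monoˡ-< (ℚ.- s) q<r+s))
          , s∈y , ≡.sym (cancel q s) }
    ; rounded   = λ where
        (r , s , r∈x , s∈y , ≡.refl) → case rounded x r∈x of λ where
          (r′ , r<r′ , r′∈x) →
            r′ ℚ.+ s , ℚ.+-monoˡ-< s r<r′ , r′ , s , r′∈x , s∈y , ≡.refl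
    }

------------------------------------------------------------------------
-- Subsets

record Subset (X : Setoid c ℓ) (p : Level) : Set (c ⊔ ℓ ⊔ lsuc p) where
  field
    Member : Unary.Pred (Setoid.Carrier X) p
    resp   : Member Respects (Setoid._≈_ X)

infix 4 _∈_ _⊆_ _≐_

_∈_ : {X : Setoid c ℓ} → Setoid.Carrier X → Subset X p → Set p
x ∈ A = Subset.Member A x

_⊆_ : {X : Setoid c ℓ} → Subset X p → Subset X o → Set (c ⊔ p ⊔ o)
_⊆_ {X = X} A B = ∀ (x : Setoid.Carrier X) → x ∈ A → x ∈ B

_≐_ : {X : Setoid c ℓ} → Subset X p → Subset X o → Set (c ⊔ p ⊔ o)
A ≐ B = A ⊆ B × B ⊆ A

-- At this level the power set contains the singletons and is closed
-- under unions indexed by the points of X.  Under excluded middle every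
-- subset of X, at whatever level, is extensionally equal to a member.

𝒫 : (X : Setoid c ℓ) → Setoid (lsuc (c ⊔ ℓ)) (c ⊔ ℓ)
𝒫 {c} {ℓ} X = record
  { Carrier       = Subset X (c ⊔ ℓ)
  ; _≈_           = _≐_
  ; isEquivalence = record
    { refl  = (λ _ → id) , (λ _ → id)
    ; sym   = λ (f , g) → g , f
    ; trans = λ (f , g) (h , k) → (λ x → h x ∘ f x) , (λ x → g x ∘ k x)
    }
  }

subsetoid : (X : Setoid c ℓ) → Subset X p → Setoid (c ⊔ p) ℓ
subsetoid X A = On.setoid {B = Σ (Setoid.Carrier X) (Subset.Member A)} X proj₁

-- Finite or countably infinite.
Countable : {X : Setoid c ℓ} → Subset X p → Set (c ⊔ ℓ ⊔ p)
Countable {X = X} A = Injection (subsetoid X A) (≡.setoid ℕ)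

full : (X : Setoid c ℓ) → Subset X p
full X = record { Member = λ _ → ⊤ ; resp = λ _ _ → _ }

infixr 7 _∩_
_∩_ : {X : Setoid c ℓ} → Subset X p → Subset X o → Subset X (p ⊔ o)
A ∩ B = record
  { Member = λ x → x ∈ A × x ∈ B
  ; resp   = λ x≈y (x∈A , x∈B) → Subset.resp A x≈y x∈A , Subset.resp B x≈y x∈B
  }

⋃ : {X : Setoid c ℓ} {I : Set o} → (I → Subset X p) → Subset X (o ⊔ p)
⋃ U = record
  { Member = λ x → ∃ λ i → x ∈ U i
  ; resp   = λ x≈y (i , x∈U) → i , Subset.resp (U i) x≈y x∈U
  }

∁ : {X : Setoid c ℓ} → Subset X p → Subset X p
∁ {X = X} A = record
  { Member = λ x → ¬ (x ∈ A)
  ; resp   = λ x≈y x∉A y∈A → x∉A (Subset.resp A (Setoid.sym X x≈y) y∈A)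
  }

------------------------------------------------------------------------
-- Topological spaces

-- The empty set is open as the union of the empty family.  By excluded
-- middle and choice a union of open sets of any size is a union indexed
-- by its points, so index types at the level of X suffice.

record Topology (X : Setoid c ℓ) (o : Level) : Set (lsuc (c ⊔ ℓ ⊔ o)) where
  field
    opens     : Subset (𝒫 X) o
    full-open : full X ∈ opens
    ∩-open    : ∀ U V → U ∈ opens → V ∈ opens → (U ∩ V) ∈ opens
    ⋃-open    : ∀ {I : Set (c ⊔ ℓ)} (U : I → Subset X (c ⊔ ℓ)) →
                (∀ i → U i ∈ opens) → ⋃ U ∈ opens

  Open : Subset X (c ⊔ ℓ) → Set o
  Open U = U ∈ opens

  Closed : Subset X (c ⊔ ℓ) → Set o
  Closed A = Open (∁ A)

-- The preimage f⁻¹(U) is given as a subset V with x ∈ V iff f x ∈ U,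
-- because X and Y may live in different universes.

Continuous : {X : Setoid c ℓ} {Y : Setoid c′ ℓ′} →
             Topology X o → Topology Y o′ → Func X Y →
             Set (lsuc (c ⊔ ℓ ⊔ c′ ⊔ ℓ′) ⊔ o ⊔ o′)
Continuous {c} {ℓ} {c′} {ℓ′} {X = X} {Y = Y} S T f =
  ∀ (U : Subset Y (c′ ⊔ ℓ′)) → Topology.Open T U →
  ∃ λ (V : Subset X (c ⊔ ℓ)) →
    Topology.Open S V × (∀ x → x ∈ V ⇔ Func.to f x ∈ U)

IsBasis : {X : Setoid c ℓ} → Topology X o → Subset (𝒫 X) p → Set (lsuc (c ⊔ ℓ) ⊔ o ⊔ p)
IsBasis T 𝒲 =
  (∀ A → A ∈ 𝒲 → Open A) ×
  (∀ U → Open U → ∀ x → x ∈ U → ∃ λ A → A ∈ 𝒲 × x ∈ A × A ⊆ U)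
  where open Topology T

productTopology : {X : Setoid c ℓ} {Y : Setoid c′ ℓ′} →
                  Topology X o → Topology Y o′ →
                  Topology (×-setoid X Y) (lsuc (c ⊔ ℓ ⊔ c′ ⊔ ℓ′) ⊔ o ⊔ o′)
productTopology {c} {ℓ} {c′} {ℓ′} {X = X} {Y = Y} S T = record
  { opens = record
    { Member = λ W → ∀ x y → (x , y) ∈ W → Box W x y
    ; resp   = λ (W⊆W′ , W′⊆W) open-W x y xy∈W′ →
        case open-W x y (W′⊆W _ xy∈W′) of λ where
          (U , V , oU , oV , x∈U , y∈V , sub) →
            U , V , oU , oV , x∈U , y∈V , λ x′ y′ u v → W⊆W′ _ (sub x′ y′ u v)
    }
  ; full-open = λ x y _ →
      full X , full Y , S.full-open , T.full-open , _ , _ , λ _ _ _ _ → _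
  ; ∩-open = λ W W′ open-W open-W′ x y (h , h′) →
      case (open-W x y h , open-W′ x y h′) of λ where
        ( (U , V , oU , oV , x∈U , y∈V , sub)
         , (U′ , V′ , oU′ , oV′ , x∈U′ , y∈V′ , sub′) ) →
          U ∩ U′ , V ∩ V′ , S.∩-open U U′ oU oU′ , T.∩-open V V′ oV oV′
          , (x∈U , x∈U′) , (y∈V , y∈V′)
          , λ x′ y′ (u , u′) (v , v′) → sub x′ y′ u v , sub′ x′ y′ u′ v′
  ; ⋃-open = λ W open-W x y (i , h) → case open-W i x y h of λ where
      (U , V , oU , oV , x∈U , y∈V , sub) →
        U , V , oU , oV , x∈U , y∈V , λ x′ y′ u v → i , sub x′ y′ u v
  }
  where
  module S = Topology S
  module T = Topology T
  Box : Subset (×-setoid X Y) (c ⊔ c′ ⊔ ℓ ⊔ ℓ′) → Setoid.Carrier X → Setoid.Carrier Y → Set _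
  Box W x y = ∃ λ (U : Subset X (c ⊔ ℓ)) → ∃ λ (V : Subset Y (c′ ⊔ ℓ′)) →
    S.Open U × T.Open V × x ∈ U × y ∈ V ×
    (∀ x′ y′ → x′ ∈ U → y′ ∈ V → (x′ , y′) ∈ W)

-- The coarsest topology making f continuous.  For injective f it is the
-- unique topology making f a homeomorphism onto its range (with the
-- subspace topology).

initialTopology : ∀ c → {X : Setoid (c ⊔ ℓ ⊔ ℓ′) ℓ} {Y : Setoid (c ⊔ ℓ ⊔ ℓ′) ℓ′} →
                  Func X Y → Topology Y o → Topology X (lsuc (c ⊔ ℓ ⊔ ℓ′) ⊔ o)
initialTopology {ℓ} {ℓ′} c {X} {Y} f T = record
  { opens = record
    { Member = λ V → ∃ λ (U : Subset Y (c ⊔ ℓ ⊔ ℓ′)) →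
                 Open U × (∀ x → x ∈ V ⇔ f.to x ∈ U)
    ; resp   = λ (V⊆V′ , V′⊆V) (U , open-U , eq) →
        U , open-U , λ x → mk⇔ (Equivalence.to (eq x) ∘ V′⊆V x)
                               (V⊆V′ x ∘ Equivalence.from (eq x))
    }
  ; full-open = full Y , full-open , λ _ → mk⇔ _ _
  ; ∩-open = λ V V′ (U , open-U , eq) (U′ , open-U′ , eq′) →
      U ∩ U′ , ∩-open U U′ open-U open-U′ , λ x → mk⇔
        (λ (v , v′) → Equivalence.to (eq x) v , Equivalence.to (eq′ x) v′)
        (λ (u , u′) → Equivalence.from (eq x) u , Equivalence.from (eq′ x) u′)
  ; ⋃-open = λ V h →
      ⋃ (proj₁ ∘ h) , ⋃-open (proj₁ ∘ h) (proj₁ ∘ proj₂ ∘ h) , λ x → mk⇔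
        (λ (i , v) → i , Equivalence.to (proj₂ (proj₂ (h i)) x) v)
        (λ (i , u) → i , Equivalence.from (proj₂ (proj₂ (h i)) x) u)
  }
  where
  open Topology T
  module f = Func f

------------------------------------------------------------------------
-- Polish spaces and Polish groups

module _ {X : Setoid c ℓ} where

  private
    Pt = Setoid.Carrier X

  IsMetric : (Pt → Pt → ℝ) → Set _
  IsMetric = IsGeneralMetric (Setoid._≈_ X) Real._≈_ Real._≤_ Real.0ℝ Real._+_

  IsCauchy : (Pt → Pt → ℝ) → (ℕ → Pt) → Set₁
  IsCauchy d s = ∀ ε → Real.0ℝ Real.< ε →
    ∃ λ N → ∀ m n → N ℕ.≤ m → N ℕ.≤ n → d (s m) (s n) Real.< ε

  ConvergesTo : (Pt → Pt → ℝ) → (ℕ → Pt) → Pt → Set₁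
  ConvergesTo d s x = ∀ ε → Real.0ℝ Real.< ε →
    ∃ λ N → ∀ n → N ℕ.≤ n → d (s n) x Real.< ε

  IsComplete : (Pt → Pt → ℝ) → Set _
  IsComplete d = ∀ s → IsCauchy d s → ∃ λ x → ConvergesTo d s x

  MetricOpen : (Pt → Pt → ℝ) → Subset X p → Set _
  MetricOpen d U = ∀ x → x ∈ U → ∃ λ r →
    Real.0ℝ Real.< r × (∀ y → d x y Real.< r → y ∈ U)

  IsCompletelyMetrizable : Topology X o → Set _
  IsCompletelyMetrizable T = ∃ λ d →
    IsMetric d × IsComplete d × (∀ U → Topology.Open T U ⇔ MetricOpen d U)

  IsSeparable : Topology X o → Set _
  IsSeparable T = ∃ λ (D : Subset X (c ⊔ ℓ)) → Countable D ×
    (∀ U → Topology.Open T U → ∃ (_∈ U) → ∃ λ x → x ∈ D × x ∈ U)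

  IsPolish : Topology X o → Set _
  IsPolish T = IsSeparable T × IsCompletelyMetrizable T

module _ (G : Group c ℓ) where

  open Group G

  mulFunc : Func (×-setoid setoid setoid) setoid
  mulFunc = record { to = λ (x , y) → x ∙ y ; cong = λ (p , q) → ∙-cong p q }

  invFunc : Func setoid setoid
  invFunc = record { to = _⁻¹ ; cong = ⁻¹-cong }

  IsTopologicalGroup : Topology setoid o → Set _
  IsTopologicalGroup T =
    Continuous (productTopology T T) T mulFunc × Continuous T T invFunc

  IsPolishGroup : Topology setoid o → Set _
  IsPolishGroup T = IsTopologicalGroup T × IsPolish T

  record IsSubgroup (H : Subset setoid p) : Set (c ⊔ p) where
    field
      ε-closed  : ε ∈ H
      ∙-closed  : ∀ x y → x ∈ H → y ∈ H → (x ∙ y) ∈ H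
      ⁻¹-closed : ∀ x → x ∈ H → (x ⁻¹) ∈ H

------------------------------------------------------------------------
-- Symmetric groups

module _ (X : Setoid c ℓ) where

  open Setoid X

  Sym : Group (c ⊔ ℓ) (c ⊔ ℓ)
  Sym = record
    { Carrier = Inverse X X
    ; _≈_     = λ σ ρ → ∀ x → to σ x ≈ to ρ x
    ; _∙_     = λ σ ρ → Inv.trans ρ σ
    ; ε       = Inv.refl X
    ; _⁻¹     = Inv.sym
    ; isGroup = record
      { isMonoid = record
        { isSemigroup = record
          { isMagma = record
            { isEquivalence = record
              { refl  = λ _ → refl
              ; sym   = λ h x → sym (h x)
              ; trans = λ h k x → trans (h x) (k x)
              }
            ; ∙-cong = λ {σ} {σ′} {ρ} {ρ′} h k x → trans (to-cong σ (k x)) (h (to ρ′ x))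
            }
          ; assoc = λ _ _ _ _ → refl
          }
        ; identity = (λ _ _ → refl) , (λ _ _ → refl)
        }
      ; inverse = (λ σ x → strictlyInverseʳ σ x) , (λ σ x → strictlyInverseˡ σ x)
      ; ⁻¹-cong = λ {σ} {ρ} h x → sym (trans
          (from-cong ρ (trans (sym (strictlyInverseˡ σ x)) (h (from σ x))))
          (strictlyInverseʳ ρ (from σ x)))
      }
    }
    where open Inverse

  -- {ρ | ρ agrees with σ on xs} is the left coset of the pointwise
  -- stabiliser of xs containing σ; these cosets are the basic open sets.
  pointwiseTopology : Topology (Group.setoid Sym) (c ⊔ ℓ)
  pointwiseTopology = record
    { opens = record
      { Member = λ U → ∀ σ → σ ∈ U → ∃ λ xs → ∀ ρ → Agree xs ρ σ → ρ ∈ U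
      ; resp   = λ (U⊆V , V⊆U) open-U σ σ∈V → case open-U σ (V⊆U σ σ∈V) of λ where
          (xs , h) → xs , λ ρ → U⊆V ρ ∘ h ρ
      }
    ; full-open = λ _ _ → [] , _
    ; ∩-open = λ U V open-U open-V σ (σ∈U , σ∈V) →
        case (open-U σ σ∈U , open-V σ σ∈V) of λ where
          ((xs , h) , (ys , k)) → xs ++ ys , λ ρ agree →
            h ρ (All.++⁻ˡ xs agree) , k ρ (All.++⁻ʳ xs agree)
    ; ⋃-open = λ U open-U σ (i , σ∈U) → case open-U i σ σ∈U of λ where
        (xs , h) → xs , λ ρ agree → i , h ρ agree
    }
    where
    Agree : List Carrier → Inverse X X → Inverse X X → Set (c ⊔ ℓ)
    Agree xs ρ σ = All (λ x → Inverse.to ρ x ≈ Inverse.to σ x) xs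

------------------------------------------------------------------------
-- Bicontinuous automorphisms

module _ (G : Group c ℓ) (T : Topology (Group.setoid G) o) where

  open Group G

  record Automorphism : Set (lsuc (c ⊔ ℓ) ⊔ o) where
    field
      perm            : Inverse setoid setoid
      isHomomorphism  : IsGroupHomomorphism rawGroup rawGroup (Inverse.to perm)
      to-continuous   : Continuous T T (Inv.toFunction perm)
      from-continuous : Continuous T T (Inv.fromFunction perm)

    open Inverse perm public
    open IsGroupHomomorphism isHomomorphism public using (homo; ε-homo; ⁻¹-homo)

  private
    continuous-id : (f : Func setoid setoid) → (∀ x → Func.to f x ≈ x) → Continuous T T f
    continuous-id f f≈id U open-U = U , open-U , λ x →
      mk⇔ (Subset.resp U (sym (f≈id x))) (Subset.resp U (f≈id x))

    continuous-∘ : (f g h : Func setoid setoid) →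
                   (∀ x → Func.to h x ≈ Func.to f (Func.to g x)) →
                   Continuous T T f → Continuous T T g → Continuous T T h
    continuous-∘ f g h eq cf cg U open-U = case cf U open-U of λ where
      (V , open-V , V⇔) → case cg V open-V of λ where
        (W , open-W , W⇔) → W , open-W , λ x → mk⇔
          (Subset.resp U (sym (eq x)) ∘ Equivalence.to (V⇔ _) ∘ Equivalence.to (W⇔ x))
          (Equivalence.from (W⇔ x) ∘ Equivalence.from (V⇔ _) ∘ Subset.resp U (eq x))

  idAut : Automorphism
  idAut = record
    { perm            = Inv.refl setoid
    ; isHomomorphism  = HomIdentity.isGroupHomomorphism rawGroup refl
    ; to-continuous   = continuous-id (Inv.toFunction (Inv.refl setoid)) (λ _ → refl)
    ; from-continuous = continuous-id (Inv.fromFunction (Inv.refl setoid)) (λ _ → refl)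
    }

  composeAut : Automorphism → Automorphism → Automorphism
  composeAut Φ Ψ = record
    { perm            = Inv.trans Ψ.perm Φ.perm
    ; isHomomorphism  = HomComposition.isGroupHomomorphism trans Ψ.isHomomorphism Φ.isHomomorphism
    ; to-continuous   = continuous-∘ (Inv.toFunction Φ.perm) (Inv.toFunction Ψ.perm)
                          (Inv.toFunction (Inv.trans Ψ.perm Φ.perm)) (λ _ → refl)
                          Φ.to-continuous Ψ.to-continuous
    ; from-continuous = continuous-∘ (Inv.fromFunction Ψ.perm) (Inv.fromFunction Φ.perm)
                          (Inv.fromFunction (Inv.trans Ψ.perm Φ.perm)) (λ _ → refl)
                          Ψ.from-continuous Φ.from-continuous
    }
    where
    module Φ = Automorphism Φ
    module Ψ = Automorphism Ψ

  inverseAut : Automorphism → Automorphism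
  inverseAut Φ = record
    { perm            = Inv.sym Φ.perm
    ; isHomomorphism  = record
      { isMonoidHomomorphism = record
        { isMagmaHomomorphism = record
          { isRelHomomorphism = record { cong = Φ.from-cong }
          ; homo = λ x y → trans
              (Φ.from-cong (sym (trans (Φ.homo _ _)
                (∙-cong (Φ.strictlyInverseˡ x) (Φ.strictlyInverseˡ y)))))
              (Φ.strictlyInverseʳ _)
          }
        ; ε-homo = trans (Φ.from-cong (sym Φ.ε-homo)) (Φ.strictlyInverseʳ ε)
        }
      ; ⁻¹-homo = λ x → trans
          (Φ.from-cong (sym (trans (Φ.⁻¹-homo _) (⁻¹-cong (Φ.strictlyInverseˡ x)))))
          (Φ.strictlyInverseʳ _)
      }
    ; to-continuous   = Φ.from-continuous
    ; from-continuous = Φ.to-continuous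
    }
    where module Φ = Automorphism Φ

  Aut : Group (lsuc (c ⊔ ℓ) ⊔ o) (c ⊔ ℓ)
  Aut = record
    { Carrier = Automorphism
    ; _≈_     = λ Φ Ψ → S._≈_ (perm Φ) (perm Ψ)
    ; _∙_     = composeAut
    ; ε       = idAut
    ; _⁻¹     = inverseAut
    ; isGroup = record
      { isMonoid = record
        { isSemigroup = record
          { isMagma = record
            { isEquivalence = On.isEquivalence perm S.isEquivalence
            ; ∙-cong = λ {Φ} {Φ′} {Ψ} {Ψ′} →
                S.∙-cong {perm Φ} {perm Φ′} {perm Ψ} {perm Ψ′}
            }
          ; assoc = λ _ _ _ _ → refl
          }
        ; identity = (λ _ _ → refl) , (λ _ _ → refl)
        }
      ; inverse = (λ Φ → S.inverseˡ (perm Φ)) , (λ Φ → S.inverseʳ (perm Φ))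
      ; ⁻¹-cong = λ {Φ} {Ψ} → S.⁻¹-cong {perm Φ} {perm Ψ}
      }
    }
    where
    module S = Group (Sym setoid)
    open Automorphism using (perm)

  actionFunc : Func (×-setoid (Group.setoid Aut) setoid) setoid
  actionFunc = record
    { to   = λ (Φ , x) → Automorphism.to Φ x
    ; cong = λ { {Φ , x} {Ψ , y} (Φ≈Ψ , x≈y) → trans (Automorphism.to-cong Φ x≈y) (Φ≈Ψ y) }
    }

  image : Automorphism → Subset setoid (c ⊔ ℓ) → Subset setoid (c ⊔ ℓ)
  image Φ A = record
    { Member = λ y → ∃ λ x → x ∈ A × Automorphism.to Φ x ≈ y
    ; resp   = λ y≈z (x , x∈A , eq) → x , x∈A , trans eq y≈z
    }

  IsInvariant : Subset (𝒫 setoid) p → Set _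
  IsInvariant 𝒲 = ∀ Φ A → A ∈ 𝒲 → image Φ A ∈ 𝒲

  image-mono : ∀ Φ A B → A ⊆ B → image Φ A ⊆ image Φ B
  image-mono Φ A B A⊆B y (x , x∈A , eq) = x , A⊆B x x∈A , eq

  image-cancel : ∀ Φ Ψ → (∀ x → Automorphism.to Φ (Automorphism.to Ψ x) ≈ x) →
                 ∀ A B → A ≐ image Ψ B → image Φ A ≐ B
  image-cancel Φ Ψ ΦΨ A B (A⊆ , ⊆A) =
      (λ y (x , x∈A , Φx≈y) → case A⊆ x x∈A of λ where
        (b , b∈B , Ψb≈x) → Subset.resp B
          (trans (sym (ΦΨ b)) (trans (Automorphism.to-cong Φ Ψb≈x) Φx≈y)) b∈B)
    , (λ y y∈B → Automorphism.to Ψ y , ⊆A _ (y , y∈B , refl) , ΦΨ y)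

------------------------------------------------------------------------
-- The representation of Aut(G) on an invariant family of open sets

module _ (G : Group c ℓ) (T : Topology (Group.setoid G) (lsuc (c ⊔ ℓ)))
         (𝒲 : Subset (𝒫 (Group.setoid G)) (lsuc (c ⊔ ℓ)))
         (invariant : IsInvariant G T 𝒲) where

  private
    A′ = Aut G T
    module A′ = Group A′
    W = subsetoid (𝒫 (Group.setoid G)) 𝒲

  imageInverse : Automorphism G T → Inverse W W
  imageInverse Φ = record
    { to        = λ (A , A∈𝒲) → image G T Φ A , invariant Φ A A∈𝒲
    ; from      = λ (A , A∈𝒲) → image G T Φ⁻¹ A , invariant Φ⁻¹ A A∈𝒲
    ; to-cong   = λ { {A , _} {B , _} (A⊆B , B⊆A) →
                    image-mono G T Φ A B A⊆B , image-mono G T Φ B A B⊆A }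
    ; from-cong = λ { {A , _} {B , _} (A⊆B , B⊆A) →
                    image-mono G T Φ⁻¹ A B A⊆B , image-mono G T Φ⁻¹ B A B⊆A }
    ; inverse   = (λ { {A , _} {B , _} → image-cancel G T Φ Φ⁻¹ (Automorphism.strictlyInverseˡ Φ) B A })
                , (λ { {A , _} {B , _} → image-cancel G T Φ⁻¹ Φ (Automorphism.strictlyInverseʳ Φ) B A })
    }
    where Φ⁻¹ = inverseAut G T Φ

  -- Φ ↦ (A ↦ Φ(A)), as a map Aut(G) → Sym(𝒲).
  representation : Func A′.setoid (Group.setoid (Sym W))
  representation = record
    { to   = imageInverse
    ; cong = λ Φ≈Ψ _ →
        (λ y (x , x∈A , eq) → x , x∈A , G.trans (G.sym (Φ≈Ψ x)) eq)
      , (λ y (x , x∈A , eq) → x , x∈A , G.trans (Φ≈Ψ x) eq)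
    }
    where module G = Group G

  range : Subset (Group.setoid (Sym W)) (lsuc (c ⊔ ℓ))
  range = record
    { Member = λ σ → ∃ λ Φ → Group._≈_ (Sym W) (imageInverse Φ) σ
    ; resp   = λ {σ} {ρ} σ≈ρ (Φ , eq) →
        Φ , Group.trans (Sym W) {imageInverse Φ} {σ} {ρ} eq σ≈ρ
    }

  autTopology : Topology A′.setoid (lsuc (lsuc (c ⊔ ℓ)))
  autTopology = initialTopology (lsuc (c ⊔ ℓ)) representation (pointwiseTopology W)

  stabiliser : List (Setoid.Carrier W) → Subset A′.setoid (lsuc (c ⊔ ℓ))
  stabiliser As = record
    { Member = λ Φ → All (λ (A , _) → image G T Φ A ≐ A) As
    ; resp   = λ {Φ} {Ψ} Φ≈Ψ → All.map λ {A} ΦA≐A →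
        Setoid.trans W {imgs Ψ A} {imgs Φ A} {A}
          (Setoid.sym W {imgs Φ A} {imgs Ψ A} (Func.cong representation {Φ} {Ψ} Φ≈Ψ A)) ΦA≐A
    }
    where
    imgs : Automorphism G T → Setoid.Carrier W → Setoid.Carrier W
    imgs Φ = Inverse.to (imageInverse Φ)

  StabilisersFormOpenBasisAtIdentity : Set _
  StabilisersFormOpenBasisAtIdentity =
    (∀ As → IsSubgroup A′ (stabiliser As) × Topology.Open autTopology (stabiliser As)) ×
    (∀ U → Topology.Open autTopology U → A′.ε ∈ U → ∃ λ As → stabiliser As ⊆ U)

{-# OPTIONS --safe #-}
module Submission where

-- Aut(G) is identified with its image in Sym(𝒲), a closed group of
-- permutations of a countable set.  Any such group is Polish: the metric
-- 1/(n+1), for the least n such that two permutations or their inverses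
-- differ at a point of index below n, is complete on Sym(𝒲) because
-- both σᵢ and σᵢ⁻¹ stabilise pointwise along a Cauchy sequence, and the finite
-- partial maps give a countable basis.  The action is continuous since
-- Φ x ∈ A ⊆ U with A ∈ 𝒲 gives Ψ(Φ⁻¹(A)) = A ⊆ U for every Ψ agreeing
-- with Φ at the basic open set Φ⁻¹(A) ∋ x.

open import Defs
open import Level using (Level; _⊔_; Lift; lift; lower) renaming (suc to lsuc)
open import Algebra.Bundles using (Group)
open import Algebra.Morphism.Structures using (IsGroupMonomorphism)
open import Axiom.ExcludedMiddle using (ExcludedMiddle)
open import Data.Integer.Base as ℤ using (+_; +[1+_]; -[1+_])
import Data.Integer.Properties as ℤ
open import Data.List.Base using (List; []; _∷_; _++_; map)
import Data.List.Extrema.Nat as List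
open import Data.List.Relation.Unary.All as All using (All; []; _∷_)
import Data.List.Relation.Unary.All.Properties as All
open import Data.Nat.Base as ℕ using (ℕ; zero; suc; s≤s)
open import Data.Nat.Binary.Base as ℕᵇ using (ℕᵇ; 2[1+_]; 1+[2_])
import Data.Nat.Binary.Properties as ℕᵇ
open import Data.Nat.Coprimality using (1-coprimeTo)
open import Data.Nat.Induction using (<-rec)
import Data.Nat.Properties as ℕ
open import Data.Product.Base using (∃; ∃₂; _×_; _,_; proj₁; proj₂)
open import Data.Rational.Base as ℚ using (ℚ; 0ℚ; 1ℚ; mkℚ; *<*)
import Data.Rational.Properties as ℚ
open import Data.Sum.Base as Sum using (_⊎_; inj₁; inj₂)
open import Data.Unit.Polymorphic.Base using (⊤)
open import Function.Base using (id; _∘_; case_of_)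
open import Function.Bundles using (Func; Inverse; Injection; _⇔_; mk⇔; module Equivalence)
open import Function.Metric.Structures using (IsGeneralMetric)
open import Relation.Binary.Bundles using (Setoid)
import Relation.Binary.Construct.On as On
open import Relation.Binary.Core using (Rel)
open import Relation.Binary.Structures using (IsEquivalence)
open import Relation.Binary.PropositionalEquality as ≡ using (_≡_)
open import Relation.Nullary using (¬_; yes; no; contradiction)
open import Relation.Nullary.Decidable
  using (False; toWitnessFalse; fromWitnessFalse; decidable-stable)

private
  variable
    c ℓ o p : Level

-- The order on 1/(n+1)

1/1+_ : ℕ → ℚ
1/1+ n = mkℚ (+ 1) n (1-coprimeTo (suc n))

1/1+-positive : ∀ n → 0ℚ ℚ.< 1/1+ n
1/1+-positive n = ℚ.positive⁻¹ (1/1+ n)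

1/1+-cancel-< : ∀ {m n} → 1/1+ m ℚ.< 1/1+ n → n ℕ.< m
1/1+-cancel-< {m} {n} (*<* lt) =
  ℕ.s<s⁻¹ (ℤ.drop‿+<+ (≡.subst₂ ℤ._<_ (ℤ.*-identityˡ (+ suc n)) (ℤ.*-identityˡ (+ suc m)) lt))

1/1+-archimedean : ∀ {q} → 0ℚ ℚ.< q → ∃ λ n → 1/1+ n ℚ.< q
1/1+-archimedean {mkℚ (+ 0) d _} (*<* (ℤ.+<+ ()))
1/1+-archimedean {mkℚ -[1+ k ] d _} (*<* ())
-- The witness 1/(d+2) lies below (k+1)/(d+1): after cross-multiplying, d+1 < d+2 ≤ (k+1)(d+2).
1/1+-archimedean {mkℚ +[1+ k ] d _} _ = suc d , *<* (ℤ.+<+ (ℕ.<-≤-trans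
  (≡.subst (ℕ._< suc (suc d)) (≡.sym (ℕ.*-identityˡ (suc d))) ℕ.≤-refl)
  (ℕ.m≤m+n (suc (suc d)) (k ℕ.* suc (suc d)))))

1/1+-≤1 : ∀ n → ¬ (1ℚ ℚ.< 1/1+ n)
1/1+-≤1 n lt with () ← 1/1+-cancel-< {0} {n} lt

-- Interpolate `r` between `q` and `s` and put `t = q - r`. This yields members of a sum of cuts
-- when one summand is only known to contain the negative rationals.
split-< : ∀ {q s} → q ℚ.< s → ∃₂ λ r t → r ℚ.< s × t ℚ.< 0ℚ × q ≡ r ℚ.+ t
split-< {q} {s} q<s with r , q<r , r<s ← ℚ.<-dense q<s =
  r , q ℚ.- r , r<s
  , ≡.subst (q ℚ.- r ℚ.<_) (ℚ.+-inverseʳ r) (ℚ.+-monoˡ-< (ℚ.- r) q<r)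
  , ≡.sym (≡.trans (≡.cong (r ℚ.+_) (ℚ.+-comm q (ℚ.- r)))
          (≡.trans (≡.sym (ℚ.+-assoc r (ℚ.- r) q))
          (≡.trans (≡.cong (ℚ._+ q) (ℚ.+-inverseʳ r)) (ℚ.+-identityˡ q))))

-- Countability

-- Zero codes the empty list, odd numbers a list with head zero, and positive even numbers a list
-- with successor head. Each case is one constructor of `ℕᵇ`, so injectivity is constructor
-- injectivity.
encode : List ℕ → ℕᵇ
encode []            = ℕᵇ.zero
encode (zero  ∷ ns)  = 1+[2 encode ns ]
encode (suc n ∷ ns)  = 2[1+ encode (n ∷ ns) ]

encode-injective : ∀ ms ns → encode ms ≡ encode ns → ms ≡ ns
encode-injective []           []           _  = ≡.refl
encode-injective []           (zero  ∷ _)  ()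
encode-injective []           (suc _ ∷ _)  ()
encode-injective (zero  ∷ _)  []           ()
encode-injective (suc _ ∷ _)  []           ()
encode-injective (zero  ∷ _)  (suc _ ∷ _)  ()
encode-injective (suc _ ∷ _)  (zero  ∷ _)  ()
encode-injective (zero  ∷ ms) (zero  ∷ ns) eq =
  ≡.cong (zero ∷_) (encode-injective ms ns (ℕᵇ.1+[2_]-injective eq))
encode-injective (suc m ∷ ms) (suc n ∷ ns) eq
  with ≡.refl ← encode-injective (m ∷ ms) (n ∷ ns) (ℕᵇ.2[1+_]-injective eq) = ≡.refl

code : List ℕ → ℕ
code = ℕᵇ.toℕ ∘ encode

code-injective : ∀ ms ns → code ms ≡ code ns → ms ≡ ns
code-injective ms ns = encode-injective ms ns ∘ ℕᵇ.toℕ-injective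

module Classical (em : ∀ {ℓ} → ExcludedMiddle ℓ) where

  -- Least witnesses and countable dense sets

  stable : {P : Set p} → ¬ ¬ P → P
  stable = decidable-stable em

  IsLeast : (ℕ → Set p) → ℕ → Set p
  IsLeast P n = P n × (∀ m → P m → n ℕ.≤ m)

  least : (P : ℕ → Set p) → ∃ P → ∃ (IsLeast P)
  least P (n , Pn) = <-rec (λ n → P n → ∃ (IsLeast P)) step n Pn
    where
    step : ∀ n → (∀ {m} → m ℕ.< n → P m → ∃ (IsLeast P)) → P n → ∃ (IsLeast P)
    step n rec Pn with em {P = ∃ λ m → m ℕ.< n × P m}
    ... | yes (m , m<n , Pm) = rec m<n Pm
    ... | no none = n , Pn , λ m Pm → ℕ.≮⇒≥ (λ m<n → none (m , m<n , Pm))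

  module _ {X : Setoid c ℓ} (s : List ℕ → Setoid.Carrier X) where

    open Setoid X

    rangeOf : Subset X (c ⊔ ℓ)
    rangeOf = record
      { Member = λ x → Lift c (∃ λ l → x ≈ s l)
      ; resp   = λ x≈y (lift (l , x≈sl)) → lift (l , trans (sym x≈y) x≈sl)
      }

    private
      Codes : Carrier → ℕ → Set ℓ
      Codes x n = ∃ λ l → code l ≡ n × x ≈ s l

      leastCode : ∀ x → x ∈ rangeOf → ∃ (IsLeast (Codes x))
      leastCode x (lift (l , x≈sl)) = least (Codes x) (code l , l , ≡.refl , x≈sl)

    -- A point may equal `s l` for many `l`. Its least code depends only on its class under `≈`, and
    -- determines the point because `code` is injective.
    rangeOf-countable : Countable rangeOf
    rangeOf-countable = record
      { to        = λ (x , x∈) → proj₁ (leastCode x x∈)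
      ; cong      = λ { {x , x∈} {y , y∈} x≈y → ℕ.≤-antisym
          (below x x∈ y y∈ x≈y) (below y y∈ x x∈ (sym x≈y)) }
      ; injective = λ { {x , x∈} {y , y∈} eq → inj x x∈ y y∈ eq }
      }
      where
      below : ∀ x x∈ y y∈ → x ≈ y → proj₁ (leastCode x x∈) ℕ.≤ proj₁ (leastCode y y∈)
      below x x∈ y y∈ x≈y with leastCode x x∈ | leastCode y y∈
      ... | m , _ , min | n , (l , eq , y≈sl) , _ = min n (l , eq , trans x≈y y≈sl)

      inj : ∀ x x∈ y y∈ → proj₁ (leastCode x x∈) ≡ proj₁ (leastCode y y∈) → x ≈ y
      inj x x∈ y y∈ m≡n with leastCode x x∈ | leastCode y y∈
      ... | m , (k , eq , x≈sk) , _ | n , (l , eq′ , y≈sl) , _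
        with ≡.refl ← code-injective k l (≡.trans eq (≡.trans m≡n (≡.sym eq′))) =
        trans x≈sk (sym y≈sl)

  -- One point is chosen from each inhabited `B l`. A `B l` around a point of `U` and inside `U`
  -- then contributes a chosen point of `U`; the sets `B l` may be arbitrary, open or not.
  separable : {X : Setoid c ℓ} (T : Topology X o) → Setoid.Carrier X →
              (B : List ℕ → Setoid.Carrier X → Set p) →
              (∀ U → Topology.Open T U → ∀ x → x ∈ U →
                 ∃ λ l → B l x × (∀ y → B l y → y ∈ U)) →
              IsSeparable T
  separable {X = X} T x₀ B basis =
    rangeOf s , rangeOf-countable s , λ U open-U (x , x∈U) → case basis U open-U x x∈U of λ where
      (l , x∈B , B⊆U) → s l , lift (l , Setoid.refl X) , B⊆U (s l) (s∈ l (x , x∈B))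
    where
    s : List ℕ → Setoid.Carrier X
    s l with em {P = ∃ (B l)}
    ... | yes (x , _) = x
    -- A default for empty `B l`; `s∈` speaks only of inhabited ones.
    ... | no _        = x₀

    s∈ : ∀ l → ∃ (B l) → B l (s l)
    s∈ l inhabited with em {P = ∃ (B l)}
    ... | yes (_ , x∈B) = x∈B
    ... | no empty      = contradiction inhabited empty

  -- Metrics

  module Ultrametric {X : Setoid c ℓ} (E : ℕ → Rel (Setoid.Carrier X) p)
    (E-equivalence : ∀ n → IsEquivalence (E n))
    (E-antitone    : ∀ {m n x y} → m ℕ.≤ n → E n x y → E m x y)
    (≈⇒E           : ∀ {n x y} → Setoid._≈_ X x y → E n x y)
    (E⇒≈           : ∀ {x y} → (∀ n → E n x y) → Setoid._≈_ X x y)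
    where

    open Setoid X
    open Real using (0ℝ; fromℚ)

    private
      module E n = IsEquivalence (E-equivalence n)

      -- Excluded middle squashes ¬ E n x y into Set, the level at which cuts live.
      Apart : ℕ → Carrier → Carrier → Set
      Apart n x y = False (em {P = E n x y})

      apart : ∀ {n x y} → ¬ E n x y → Apart n x y
      apart = fromWitnessFalse

      ¬apart : ∀ {n x y} → Apart n x y → ¬ E n x y
      ¬apart = toWitnessFalse

    -- The supremum of 0 and of the 1/(n+1) for which E n fails.
    d : Carrier → Carrier → ℝ
    d x y = record
      { Below     = λ q → q ℚ.< 0ℚ ⊎ ∃ λ n → Apart n x y × q ℚ.< 1/1+ n
      ; inhabited = ℚ.- 1ℚ , inj₁ (ℚ.negative⁻¹ (ℚ.- 1ℚ))
      ; proper    = 1ℚ , λ where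
          (inj₁ 1<0)         → ℚ.<-asym 1<0 (ℚ.positive⁻¹ 1ℚ)
          (inj₂ (n , _ , q)) → 1/1+-≤1 n q
      ; down      = λ r∈ q<r → Sum.map (ℚ.<-trans q<r)
                      (λ (n , ap , r<) → n , ap , ℚ.<-trans q<r r<) r∈
      ; rounded   = λ where
          (inj₁ q<0) → case ℚ.<-dense q<0 of λ where
            (r , q<r , r<0) → r , q<r , inj₁ r<0
          (inj₂ (n , ap , q<)) → case ℚ.<-dense q< of λ where
            (r , q<r , r<) → r , q<r , inj₂ (n , ap , r<)
      }

    d-mono : ∀ {x y x′ y′} → (∀ n → E n x′ y′ → E n x y) → d x y Real.≤ d x′ y′
    d-mono f q = Sum.map₂ λ (n , ap , q<) → n , apart (¬apart ap ∘ f n) , q<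

    d-cong : ∀ {x y x′ y′} → (∀ n → E n x y ⇔ E n x′ y′) → d x y Real.≈ d x′ y′
    d-cong eq = d-mono (Equivalence.from ∘ eq) , d-mono (Equivalence.to ∘ eq)

    -- Were `E n` to fail, 1/(n+1) would be one of the terms of the supremum.
    d<1/1+⇒E : ∀ {n x y} → d x y Real.< fromℚ (1/1+ n) → E n x y
    d<1/1+⇒E {n} (q , q∉d , q<) = stable λ ¬E → q∉d (inj₂ (n , apart ¬E , q<))

    -- By antitonicity every level where `E` fails exceeds `n`, so 1/(n+1) is not below the
    -- distance. It separates the distance from ε once it lies below ε.
    E⇒d< : ∀ {ε} → 0ℝ Real.< ε → ∃ λ n → ∀ {x y} → E n x y → d x y Real.< ε
    -- Since `q` may be 0, roundedness is used to get a strictly positive `r` below ε.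
    E⇒d< {ε} (q , q≮0 , q∈ε) with r , q<r , r∈ε ← ℝ.rounded ε q∈ε
      with n , n<r ← 1/1+-archimedean (ℚ.≤-<-trans (ℚ.≮⇒≥ q≮0) q<r) =
      n , λ Exy → 1/1+ n
        , (λ where
            (inj₁ n<0)         → ℚ.<-asym n<0 (1/1+-positive n)
            (inj₂ (m , ap , lt)) → ¬apart ap (E-antitone (ℕ.<⇒≤ (1/1+-cancel-< lt)) Exy))
        , ℝ.down ε r∈ε n<r

    1/1+-positiveℝ : ∀ n → 0ℝ Real.< fromℚ (1/1+ n)
    1/1+-positiveℝ n = 0ℚ , ℚ.<-irrefl ≡.refl , 1/1+-positive n

    d≤0⇒E : ∀ {x y} → d x y Real.≤ 0ℝ → ∀ n → E n x y
    d≤0⇒E d≤0 n = stable λ ¬E →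
      ℚ.<-irrefl ≡.refl (d≤0 0ℚ (inj₂ (n , apart ¬E , 1/1+-positive n)))

    -- By transitivity, a level failing for `x` and `z` fails for `x` and `y` or for `y` and `z`.
    -- That distance alone bounds `q`; the other contributes only a negative rational.
    d-triangle : ∀ x y z → d x z Real.≤ d x y Real.+ d y z
    d-triangle x y z q (inj₁ q<0) with r , t , r<0 , t<0 , eq ← split-< q<0 =
      r , t , inj₁ r<0 , inj₁ t<0 , eq
    d-triangle x y z q (inj₂ (n , ap , q<)) with split-< q< | em {P = E n x y}
    ... | r , t , r< , t<0 , eq | no ¬Exy =
      r , t , inj₂ (n , apart ¬Exy , r<) , inj₁ t<0 , eq
    ... | r , t , r< , t<0 , eq | yes Exy =
      t , r , inj₁ t<0 , inj₂ (n , apart (¬apart ap ∘ E.trans n Exy) , r<)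
      , ≡.trans eq (ℚ.+-comm r t)

    d-isMetric : IsMetric {X = X} d
    d-isMetric = record
      { isSemiMetric = record
        { isQuasiSemiMetric = record
          { isPreMetric = record
            { isProtoMetric = record
              { isPartialOrder = record
                { isPreorder = record
                  { isEquivalence = record
                    { refl  = (λ _ → id) , (λ _ → id)
                    ; sym   = λ (f , g) → g , f
                    ; trans = λ (f , g) (h , k) → (λ q → h q ∘ f q) , (λ q → g q ∘ k q)
                    }
                  ; reflexive = proj₁
                  ; trans     = λ f g q → g q ∘ f q
                  }
                ; antisym = _,_
                }
              ; ≈-isEquivalence = isEquivalence
              ; cong = λ x≈x′ y≈y′ → d-cong λ n → mk⇔
                  (λ Exy → E.trans n (E.sym n (≈⇒E x≈x′)) (E.trans n Exy (≈⇒E y≈y′)))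
                  (λ Exy → E.trans n (≈⇒E x≈x′) (E.trans n Exy (E.sym n (≈⇒E y≈y′))))
              ; nonNegative = λ _ → inj₁
              }
            ; ≈⇒0 = λ x≈y → (λ where
                _ (inj₁ q<0)          → q<0
                _ (inj₂ (_ , ap , _)) → contradiction (≈⇒E x≈y) (¬apart ap))
              , λ _ → inj₁
            }
          ; 0⇒≈ = λ d≈0 → E⇒≈ (d≤0⇒E (proj₁ d≈0))
          }
        ; sym = λ x y → d-cong λ n → mk⇔ (E.sym n) (E.sym n)
        }
      ; triangle = d-triangle
      }

    -- The balls of `d` and the classes of the `E n` refine each other, so openness, Cauchy
    -- sequences and limits can all be tested on the `E n`.
    completelyMetrizable : (T : Topology X o) →
      (∀ U → Topology.Open T U ⇔ (∀ x → x ∈ U → ∃ λ n → ∀ y → E n x y → y ∈ U)) →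
      (∀ (s : ℕ → Carrier) → (∀ n → ∃ λ N → ∀ i j → N ℕ.≤ i → N ℕ.≤ j → E n (s i) (s j)) →
         ∃ λ x → ∀ n → ∃ λ N → ∀ i → N ℕ.≤ i → E n (s i) x) →
      IsCompletelyMetrizable T
    completelyMetrizable T open⇔ complete = d , d-isMetric
      , (λ s cauchy → case complete s (λ n → case cauchy (fromℚ (1/1+ n)) (1/1+-positiveℝ n) of λ where
           (N , close) → N , λ i j N≤i N≤j → d<1/1+⇒E (close i j N≤i N≤j)) of λ where
          (x , lim) → x , λ ε ε>0 → case E⇒d< {ε} ε>0 of λ where
            (n , E⇒d) → case lim n of λ where
              (N , close) → N , λ i N≤i → E⇒d (close i N≤i))
      , λ U → mk⇔
          (λ open-U x x∈U → case Equivalence.to (open⇔ U) open-U x x∈U of λ where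
            (n , sub) → fromℚ (1/1+ n) , 1/1+-positiveℝ n , λ y d< → sub y (d<1/1+⇒E d<))
          (λ open-U → Equivalence.from (open⇔ U) λ x x∈U → case open-U x x∈U of λ where
            (r , r>0 , sub) → case E⇒d< {r} r>0 of λ where
              (n , E⇒d) → n , λ y Exy → sub y (E⇒d Exy))

  -- The ball about `x` of radius `d x y` misses `y`. Closedness of points is what later separates
  -- two automorphisms.
  coSingleton-open : {X : Setoid c ℓ} (T : Topology X o) → IsCompletelyMetrizable T → ∀ y →
    ∃ λ U → Topology.Open T U × (∀ x → x ∈ U ⇔ (¬ Setoid._≈_ X x y))
  coSingleton-open {c} {ℓ} {X = X} T (d , isMetric , _ , open⇔) y =
    U , Equivalence.from (open⇔ U) metricOpen , λ x → mk⇔ lower lift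
    where
    open Setoid X
    module d = IsGeneralMetric isMetric

    U : Subset X (c ⊔ ℓ)
    U = record
      { Member = λ x → Lift c (¬ x ≈ y)
      ; resp   = λ x≈z (lift x≉y) → lift (x≉y ∘ trans x≈z)
      }

    positive : ∀ {x} → ¬ x ≈ y → Real.0ℝ Real.< d x y
    positive x≉y = stable λ ¬pos → x≉y (d.0⇒≈
      ( (λ q q∈d → stable λ q≮0 → ¬pos (q , q≮0 , q∈d))
      , d.nonNegative ))

    metricOpen : MetricOpen d U
    metricOpen x (lift x≉y) = d x y , positive x≉y , λ z (q , q∉ , q∈) →
      lift λ z≈y → q∉ (proj₂ (d.cong refl z≈y) q q∈)

  -- Closed groups of permutations of a countable set

  module PermutationGroup {u v} (X : Setoid (u ⊔ v) v)
    (index : Injection X (≡.setoid ℕ)) (H : Group (u ⊔ v) v)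
    (ι : Func (Group.setoid H) (Group.setoid (Sym X)))
    (ι-mono : IsGroupMonomorphism (Group.rawGroup H) (Group.rawGroup (Sym X)) (Func.to ι))
    where

    open Setoid X
    open Inverse using (to; from; to-cong; from-cong; strictlyInverseˡ; strictlyInverseʳ)
    private
      module H = Group H
      module S = Group (Sym X)
      module ι = IsGroupMonomorphism ι-mono
      open Injection index using (injective) renaming (to to #; cong to #-cong)

      ⟦_⟧ : H.Carrier → Inverse X X
      ⟦_⟧ = Func.to ι

    infixr 8 _·_
    _·_ : H.Carrier → Carrier → Carrier
    h · x = to ⟦ h ⟧ x

    ·-cong : ∀ h {x y} → x ≈ y → h · x ≈ h · y
    ·-cong h = to-cong ⟦ h ⟧

    -- The topology pulled back from the symmetric group

    Agree : List Carrier → Inverse X X → Inverse X X → Set (u ⊔ v)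
    Agree xs σ ρ = All (λ x → to σ x ≈ to ρ x) xs

    -- For Aut(G) this is `autTopology` by definition.
    τ : Topology H.setoid (lsuc (u ⊔ v))
    τ = initialTopology u ι (pointwiseTopology X)

    open Topology τ using (Open)

    open⇔ : ∀ V → Open V ⇔ (∀ h → h ∈ V → ∃ λ xs → ∀ k → Agree xs ⟦ k ⟧ ⟦ h ⟧ → k ∈ V)
    open⇔ V = mk⇔
      (λ (U , open-U , eq) h h∈V → case open-U ⟦ h ⟧ (Equivalence.to (eq h) h∈V) of λ where
        (xs , sub) → xs , λ k agree → Equivalence.from (eq k) (sub ⟦ k ⟧ agree))
      -- The open set of `Sym X` inducing `V` consists of all σ having a basic neighbourhood that
      -- meets the image of `H` only inside `V`.
      (λ nbhds → record
           { Member = λ σ → ∃ λ xs → ∀ k → Agree xs ⟦ k ⟧ σ → k ∈ V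
           ; resp   = λ σ≈ρ (xs , sub) → xs , λ k agree →
               sub k (All.map (λ {x} kx≈ρx → trans kx≈ρx (sym (σ≈ρ x))) agree)
           }
        , (λ σ (xs , sub) → xs , λ ρ ρσ → xs , λ k kρ →
             sub k (All.zipWith (λ (p , q) → trans p q) (kρ , ρσ)))
        , λ h → mk⇔ (nbhds h) (λ (xs , sub) → sub h (All.tabulate λ _ → refl)))

    coset : List Carrier → H.Carrier → Subset H.setoid (u ⊔ v)
    coset xs h = record
      { Member = λ k → Agree xs ⟦ k ⟧ ⟦ h ⟧
      ; resp   = λ k≈l → All.map (λ {x} → trans (sym (ι.⟦⟧-cong k≈l x)))
      }

    coset-open : ∀ xs h → Open (coset xs h)
    coset-open xs h = Equivalence.from (open⇔ (coset xs h)) λ k kh → xs , λ l lk →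
      All.zipWith (λ (p , q) → trans p q) (lk , kh)

    ∈-coset : ∀ xs h → h ∈ coset xs h
    ∈-coset xs h = All.tabulate λ _ → refl

    stab : List Carrier → Subset H.setoid (u ⊔ v)
    stab xs = record
      { Member = λ h → All (λ x → h · x ≈ x) xs
      ; resp   = λ h≈k → All.map (λ {x} → trans (sym (ι.⟦⟧-cong h≈k x)))
      }

    stab-isSubgroup : ∀ xs → IsSubgroup H (stab xs)
    stab-isSubgroup xs = record
      { ε-closed  = All.tabulate λ {x} _ → ι.ε-homo x
      ; ∙-closed  = λ h k hx kx → All.zipWith
          (λ {x} (hx≈x , kx≈x) → trans (ι.∙-homo h k x) (trans (·-cong h kx≈x) hx≈x)) (hx , kx)
      ; ⁻¹-closed = λ h → All.map λ {x} hx≈x → trans (ι.⁻¹-homo h x)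
          (trans (from-cong ⟦ h ⟧ (sym hx≈x)) (strictlyInverseʳ ⟦ h ⟧ x))
      }

    stab-open : ∀ xs → Open (stab xs)
    stab-open xs = Equivalence.from (open⇔ (stab xs)) λ h hx → xs , λ k kh →
      All.zipWith (λ (p , q) → trans p q) (kh , hx)

    stab-basis : ∀ U → Open U → H.ε ∈ U → ∃ λ xs → stab xs ⊆ U
    stab-basis U open-U ε∈U with xs , sub ← Equivalence.to (open⇔ U) open-U H.ε ε∈U =
      xs , λ h hx → sub h (All.map (λ {x} hx≈x → trans hx≈x (sym (ι.ε-homo x))) hx)

    -- Continuity of the group operations

    ∙-continuous : Continuous (productTopology τ τ) τ (mulFunc H)
    ∙-continuous U open-U = V , V-open , λ _ → mk⇔ id id
      where
      V : Subset _ (u ⊔ v)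
      V = record
        { Member = λ (h , k) → (h H.∙ k) ∈ U
        ; resp   = λ (p , q) → Subset.resp U (H.∙-cong p q)
        }

      V-open : Topology.Open (productTopology τ τ) V
      V-open h k hk∈U with xs , sub ← Equivalence.to (open⇔ U) open-U (h H.∙ k) hk∈U =
        -- To preserve `h · k · x`, keep the value of `k` at `x` and that of `h` at `k · x`.
        coset (map (k ·_) xs) h , coset xs k
        , coset-open (map (k ·_) xs) h , coset-open xs k
        , ∈-coset (map (k ·_) xs) h , ∈-coset xs k
        , λ h′ k′ h′h k′k → sub (h′ H.∙ k′) (All.zipWith
            (λ {x} (p , q) → trans (ι.∙-homo h′ k′ x)
              (trans (·-cong h′ p) (trans q (sym (ι.∙-homo h k x)))))
            (k′k , All.map⁻ h′h))

    ⁻¹-continuous : Continuous τ τ (invFunc H)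
    ⁻¹-continuous U open-U = V , Equivalence.from (open⇔ V) V-open , λ _ → mk⇔ id id
      where
      V : Subset H.setoid (u ⊔ v)
      V = record
        { Member = λ h → (h H.⁻¹) ∈ U
        ; resp   = Subset.resp U ∘ H.⁻¹-cong
        }

      V-open : ∀ h → h ∈ V → ∃ λ xs → ∀ k → Agree xs ⟦ k ⟧ ⟦ h ⟧ → k ∈ V
      V-open h h⁻¹∈U with xs , sub ← Equivalence.to (open⇔ U) open-U (h H.⁻¹) h⁻¹∈U =
        -- If `k` agrees with `h` at the point that `h` sends to `x`, then both inverses send `x` to
        -- that point.
        map (from ⟦ h ⟧) xs , λ k agree → sub (k H.⁻¹) (All.map
          (λ {x} kh⁻¹x≈hh⁻¹x → trans (ι.⁻¹-homo k x)
            (trans (from-cong ⟦ k ⟧ (sym (trans kh⁻¹x≈hh⁻¹x (strictlyInverseˡ ⟦ h ⟧ x))))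
            (trans (strictlyInverseʳ ⟦ k ⟧ _) (sym (ι.⁻¹-homo h x)))))
          (All.map⁻ agree))

    isTopologicalGroup : IsTopologicalGroup H τ
    isTopologicalGroup = ∙-continuous , ⁻¹-continuous

    -- A list a₁ ∷ b₁ ∷ a₂ ∷ b₂ ∷ ⋯ codes the finite partial map sending
    -- the point with index aᵢ to the one with index bᵢ.
    Realises : List ℕ → H.Carrier → Set (u ⊔ v)
    Realises (m ∷ n ∷ ns) h = (∀ x → # x ≡ m → # (h · x) ≡ n) × Realises ns h
    Realises _            h = ⊤

    trace : List Carrier → H.Carrier → List ℕ
    trace []       h = []
    trace (x ∷ xs) h = # x ∷ # (h · x) ∷ trace xs h

    realises-trace : ∀ xs h → Realises (trace xs h) h
    realises-trace []       h = _
    realises-trace (x ∷ xs) h = (λ y eq → #-cong (·-cong h (injective eq))) , realises-trace xs h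

    realises⇒agree : ∀ xs {h k} → Realises (trace xs h) k → Agree xs ⟦ k ⟧ ⟦ h ⟧
    realises⇒agree []       _        = []
    realises⇒agree (x ∷ xs) (r , rs) = injective (r x ≡.refl) ∷ realises⇒agree xs rs

    -- The sets `Realises l` are indexed by lists of naturals, and the one coded by `trace xs h`
    -- contains `h` and lies in the basic coset of `h` at `xs`.
    isSeparable : IsSeparable τ
    isSeparable = separable τ H.ε Realises λ U open-U h h∈U →
      case Equivalence.to (open⇔ U) open-U h h∈U of λ where
        (xs , sub) → trace xs h , realises-trace xs h , λ k r → sub k (realises⇒agree xs r)

    -- The complete metric on permutations

    E : ℕ → Inverse X X → Inverse X X → Set (u ⊔ v)
    E n σ ρ = ∀ x → # x ℕ.< n → to σ x ≈ to ρ x × from σ x ≈ from ρ x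

    private
      bound : ∀ xs → ∃ λ n → All (λ x → # x ℕ.< n) xs
      bound xs = suc (List.max 0 (map # xs)) , All.map s≤s (All.map⁻ (List.xs≤max 0 (map # xs)))

      -- By injectivity of the index at most one point has index `n`, and excluded middle decides
      -- whether there is one. So finitely many points represent all those of index below `n`.
      below : ∀ n → ∃ λ xs → ∀ σ ρ → Agree xs σ ρ → ∀ x → # x ℕ.< n → to σ x ≈ to ρ x
      below zero = [] , λ _ _ _ _ ()
      below (suc n) with xs , cover ← below n | em {P = ∃ λ x → # x ≡ n}
      ... | no none = xs , λ σ ρ agree x #x<1+n →
        cover σ ρ agree x (ℕ.≤∧≢⇒< (ℕ.s≤s⁻¹ #x<1+n) (λ eq → none (x , eq)))
      ... | yes (y , #y≡n) = y ∷ xs , λ where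
        σ ρ (σy≈ρy ∷ agree) x #x<1+n → case # x ℕ.≟ n of λ where
          (yes #x≡n) → case injective (≡.trans #x≡n (≡.sym #y≡n)) of λ x≈y →
            trans (to-cong σ x≈y) (trans σy≈ρy (to-cong ρ (sym x≈y)))
          (no #x≢n) → cover σ ρ agree x (ℕ.≤∧≢⇒< (ℕ.s≤s⁻¹ #x<1+n) #x≢n)

    agree⇒E : ∀ n ρ → ∃ λ xs → ∀ σ → Agree xs σ ρ → E n σ ρ
    -- Agreement at the ρ-preimages of `xs` forces the inverses to agree on `xs`. The list depends
    -- on ρ, which suffices for comparing topologies.
    agree⇒E n ρ with xs , cover ← below n = xs ++ map (from ρ) xs , λ σ agree x #x<n →
      cover σ ρ (All.++⁻ˡ xs agree) x #x<n
      , cover (σ S.⁻¹) (ρ S.⁻¹) (All.map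
          (λ {y} σρ⁻¹y≈ρρ⁻¹y →
            trans (from-cong σ (sym (trans σρ⁻¹y≈ρρ⁻¹y (strictlyInverseˡ ρ y))))
                  (strictlyInverseʳ σ (from ρ y)))
          (All.map⁻ (All.++⁻ʳ xs agree))) x #x<n

    E⇒agree : ∀ xs → ∃ λ n → ∀ {σ ρ} → E n σ ρ → Agree xs σ ρ
    E⇒agree xs with n , bnd ← bound xs = n , λ Eσρ → All.map (λ {x} → proj₁ ∘ Eσρ x) bnd

    E-equivalence : ∀ n → IsEquivalence (E n)
    E-equivalence n = record
      { refl  = λ _ _ → refl , refl
      ; sym   = λ f x lt → sym (proj₁ (f x lt)) , sym (proj₂ (f x lt))
      ; trans = λ f g x lt → trans (proj₁ (f x lt)) (proj₁ (g x lt))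
                           , trans (proj₂ (f x lt)) (proj₂ (g x lt))
      }

    E-antitone : ∀ {m n σ ρ} → m ℕ.≤ n → E n σ ρ → E m σ ρ
    E-antitone m≤n f x lt = f x (ℕ.<-≤-trans lt m≤n)

    module Limit (s : ℕ → Inverse X X) (N : ℕ → ℕ)
      (cauchy : ∀ n i j → N n ℕ.≤ i → N n ℕ.≤ j → E n (s i) (s j)) where

      private
        stage : Carrier → ℕ
        -- The successor, because `E n` controls only indices strictly below `n`.
        stage x = N (suc (# x))

        -- Both sides are compared with a later term `s j`: one at level `n`, the other at the level
        -- defining `stage x`.
        to-stable : ∀ n x i → # x ℕ.< n → N n ℕ.≤ i → to (s i) x ≈ to (s (stage x)) x
        to-stable n x i lt N≤i = trans
          (proj₁ (cauchy n i j N≤i (ℕ.m≤n⇒m≤n⊔o (stage x) N≤i) x lt))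
          (proj₁ (cauchy _ j _ (ℕ.m≤n⊔m i (stage x)) ℕ.≤-refl x ℕ.≤-refl))
          where j = i ℕ.⊔ stage x

        from-stable : ∀ n x i → # x ℕ.< n → N n ℕ.≤ i → from (s i) x ≈ from (s (stage x)) x
        from-stable n x i lt N≤i = trans
          (proj₂ (cauchy n i j N≤i (ℕ.m≤n⇒m≤n⊔o (stage x) N≤i) x lt))
          (proj₂ (cauchy _ j _ (ℕ.m≤n⊔m i (stage x)) ℕ.≤-refl x ℕ.≤-refl))
          where j = i ℕ.⊔ stage x

        common : Carrier → Carrier → ℕ
        common x y = stage x ℕ.⊔ stage y

        to-common : ∀ x y → to (s (common x y)) x ≈ to (s (stage x)) x
        to-common x y = to-stable _ x _ ℕ.≤-refl (ℕ.m≤m⊔n (stage x) (stage y))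

        from-common : ∀ x y → from (s (common y x)) x ≈ from (s (stage x)) x
        from-common x y = from-stable _ x _ ℕ.≤-refl (ℕ.m≤n⊔m (stage y) (stage x))

        same-stage : ∀ {x y} → x ≈ y → stage x ≡ stage y
        same-stage x≈y = ≡.cong (N ∘ suc) (#-cong x≈y)

        limTo limFrom : Carrier → Carrier
        limTo x   = to (s (stage x)) x
        limFrom x = from (s (stage x)) x

        limTo-cong : ∀ {x y} → x ≈ y → limTo x ≈ limTo y
        limTo-cong {x} {y} x≈y = ≡.subst (λ i → limTo x ≈ to (s i) y) (same-stage x≈y)
          (to-cong (s (stage x)) x≈y)

        limFrom-cong : ∀ {x y} → x ≈ y → limFrom x ≈ limFrom y
        limFrom-cong {x} {y} x≈y = ≡.subst (λ i → limFrom x ≈ from (s i) y) (same-stage x≈y)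
          (from-cong (s (stage x)) x≈y)

        -- At a stage late enough for both points, `limTo` and `limFrom` are computed by one
        -- permutation `s i` and its inverse, which cancel.
        limTo-limFrom : ∀ x → limTo (limFrom x) ≈ x
        limTo-limFrom x =
          trans (sym (to-common (limFrom x) x))
          (trans (to-cong (s i) (sym (from-common x (limFrom x))))
          (strictlyInverseˡ (s i) x))
          where i = common (limFrom x) x

        limFrom-limTo : ∀ x → limFrom (limTo x) ≈ x
        limFrom-limTo x =
          trans (sym (from-common (limTo x) x))
          (trans (from-cong (s i) (sym (to-common x (limTo x))))
          (strictlyInverseʳ (s i) x))
          where i = common x (limTo x)

      lim : Inverse X X
      lim = record
        { to        = limTo
        ; from      = limFrom
        ; to-cong   = limTo-cong
        ; from-cong = limFrom-cong
        ; inverse   = (λ {x} y≈ → trans (limTo-cong y≈) (limTo-limFrom x))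
                    , (λ {x} y≈ → trans (limFrom-cong y≈) (limFrom-limTo x))
        }

      converges : ∀ n i → N n ℕ.≤ i → E n (s i) lim
      converges n i N≤i x lt = to-stable n x i lt N≤i , from-stable n x i lt N≤i

    -- Closedness of the image of `ι` in the pointwise topology, unfolded.
    IsClosedRange : Set _
    IsClosedRange = ∀ σ → ¬ (∃ λ h → ⟦ h ⟧ S.≈ σ) →
      ∃ λ xs → ∀ ρ → Agree xs ρ σ → ¬ (∃ λ h → ⟦ h ⟧ S.≈ ρ)

    isCompletelyMetrizable : IsClosedRange → IsCompletelyMetrizable τ
    isCompletelyMetrizable closed = completelyMetrizable τ metric-open⇔ complete
      where
      Eᴴ : ℕ → Rel H.Carrier (u ⊔ v)
      Eᴴ n h k = E n ⟦ h ⟧ ⟦ k ⟧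

      Eᴴ-equivalence : ∀ n → IsEquivalence (Eᴴ n)
      Eᴴ-equivalence n = On.isEquivalence ⟦_⟧ (E-equivalence n)

      Eᴴ-antitone : ∀ {m n h k} → m ℕ.≤ n → Eᴴ n h k → Eᴴ m h k
      Eᴴ-antitone {h = h} {k} = E-antitone {σ = ⟦ h ⟧} {ρ = ⟦ k ⟧}

      ≈⇒Eᴴ : ∀ {n h k} → h H.≈ k → Eᴴ n h k
      ≈⇒Eᴴ {h = h} {k} h≈k x _ =
        ι.⟦⟧-cong h≈k x , S.⁻¹-cong {⟦ h ⟧} {⟦ k ⟧} (ι.⟦⟧-cong h≈k) x

      Eᴴ⇒≈ : ∀ {h k} → (∀ n → Eᴴ n h k) → h H.≈ k
      Eᴴ⇒≈ all = ι.injective λ x → proj₁ (all (suc (# x)) x ℕ.≤-refl)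

      open Ultrametric {X = H.setoid} Eᴴ Eᴴ-equivalence
        (λ {m} {n} {h} {k} → Eᴴ-antitone {m} {n} {h} {k}) (λ {n} → ≈⇒Eᴴ {n}) Eᴴ⇒≈

      metric-open⇔ : ∀ U → Open U ⇔ (∀ h → h ∈ U → ∃ λ n → ∀ k → Eᴴ n h k → k ∈ U)
      metric-open⇔ U = mk⇔
        (λ open-U h h∈U → case Equivalence.to (open⇔ U) open-U h h∈U of λ where
          (xs , sub) → case E⇒agree xs of λ where
            (n , E⇒) → n , λ k Ehk → sub k
              (E⇒ {⟦ k ⟧} {⟦ h ⟧} (IsEquivalence.sym (Eᴴ-equivalence n) {h} {k} Ehk)))
        (λ nbhds → Equivalence.from (open⇔ U) λ h h∈U → case nbhds h h∈U of λ where
          (n , sub) → case agree⇒E n ⟦ h ⟧ of λ where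
            (xs , ⇒E) → xs , λ k agree → sub k
              (IsEquivalence.sym (Eᴴ-equivalence n) {k} {h} (⇒E ⟦ k ⟧ agree)))

      complete : (s : ℕ → H.Carrier) →
        (∀ n → ∃ λ N → ∀ i j → N ℕ.≤ i → N ℕ.≤ j → Eᴴ n (s i) (s j)) →
        ∃ λ h → ∀ n → ∃ λ N → ∀ i → N ℕ.≤ i → Eᴴ n (s i) h
      complete s cauchy = case inRange of λ where
          (h , h≈lim) → h , λ n → proj₁ (cauchy n) , λ i N≤i x lt →
              trans (proj₁ (converges n i N≤i x lt)) (sym (h≈lim x))
            , trans (proj₂ (converges n i N≤i x lt)) (sym (S.⁻¹-cong {⟦ h ⟧} {lim} h≈lim x))
        where
        open Limit (⟦_⟧ ∘ s) (proj₁ ∘ cauchy) (proj₂ ∘ cauchy)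

        inRange : ∃ λ h → ⟦ h ⟧ S.≈ lim
        -- Otherwise a basic neighbourhood of `lim` would avoid the range, yet the sequence enters
        -- it.
        inRange = stable λ ∉range → case closed lim ∉range of λ where
          (xs , misses) → case E⇒agree xs of λ where
            (n , E⇒) → misses ⟦ s (proj₁ (cauchy n)) ⟧
              (E⇒ {⟦ s (proj₁ (cauchy n)) ⟧} {lim} (converges n _ ℕ.≤-refl))
              (s (proj₁ (cauchy n)) , λ _ → refl)

    isPolishGroup : IsClosedRange → IsPolishGroup H τ
    isPolishGroup closed = isTopologicalGroup , isSeparable , isCompletelyMetrizable closed

  -- The action of Aut(G) on an invariant basis

  module AutomorphismAction {c ℓ} (G : Group c ℓ)
    (T : Topology (Group.setoid G) (lsuc (c ⊔ ℓ)))
    (𝒲 : Subset (𝒫 (Group.setoid G)) (lsuc (c ⊔ ℓ)))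
    (metrizable : IsCompletelyMetrizable T) (countable : Countable 𝒲)
    (basis : IsBasis T 𝒲) (invariant : IsInvariant G T 𝒲) where

    open Group G
    open Automorphism using (to; strictlyInverseʳ)

    private
      W = subsetoid (𝒫 setoid) 𝒲
      ι = representation G T 𝒲 invariant

    -- If Φ x ≠ Ψ x, continuity of Φ gives a basic `A` around `x` such that Φ(A) misses Ψ x. But
    -- Ψ(A) contains Ψ x, so the two images differ.
    ι-injective : ∀ {Φ Ψ} → Group._≈_ (Sym W) (Func.to ι Φ) (Func.to ι Ψ) → Group._≈_ (Aut G T) Φ Ψ
    ι-injective {Φ} {Ψ} ΦA≐ΨA x = stable λ Φx≉Ψx →
      case coSingleton-open T metrizable (to Ψ x) of λ where
        (U , open-U , U⇔) → case Automorphism.to-continuous Φ U open-U of λ where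
          (V , open-V , V⇔) →
            case proj₂ basis V open-V x
                   (Equivalence.from (V⇔ x) (Equivalence.from (U⇔ _) Φx≉Ψx)) of λ where
              (A , A∈𝒲 , x∈A , A⊆V) →
                case proj₂ (ΦA≐ΨA (A , A∈𝒲)) (to Ψ x) (x , x∈A , refl) of λ where
                  (y , y∈A , Φy≈Ψx) →
                    Equivalence.to (U⇔ (to Φ y)) (Equivalence.to (V⇔ y) (A⊆V y y∈A)) Φy≈Ψx

    ι-isMonomorphism :
      IsGroupMonomorphism (Group.rawGroup (Aut G T)) (Group.rawGroup (Sym W)) (Func.to ι)
    ι-isMonomorphism = record
      { isGroupHomomorphism = record
        { isMonoidHomomorphism = record
          { isMagmaHomomorphism = record
            { isRelHomomorphism = record { cong = λ {Φ} {Ψ} → Func.cong ι {Φ} {Ψ} }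
            ; homo = λ Φ Ψ _ →
                (λ y (x , x∈A , eq) → to Ψ x , (x , x∈A , refl) , eq)
              , (λ { y (z , (x , x∈A , Ψx≈z) , Φz≈y) →
                       x , x∈A , trans (Automorphism.to-cong Φ Ψx≈z) Φz≈y })
            }
          ; ε-homo = λ (A , _) →
              (λ y (x , x∈A , x≈y) → Subset.resp A x≈y x∈A) , (λ y y∈A → y , y∈A , refl)
          }
        ; ⁻¹-homo = λ _ _ → (λ _ → id) , (λ _ → id)
        }
      ; injective = λ {Φ} {Ψ} → ι-injective {Φ} {Ψ}
      }

    open PermutationGroup {lsuc (c ⊔ ℓ)} {c ⊔ ℓ} W countable (Aut G T) ι ι-isMonomorphism public

    action-continuous :
      Continuous (productTopology (autTopology G T 𝒲 invariant) T) T (actionFunc G T)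
    action-continuous U open-U = V , V-open , λ _ → mk⇔ lower lift
      where
      V : Subset _ (lsuc (c ⊔ ℓ))
      V = record
        { Member = λ (Φ , x) → Lift (lsuc (c ⊔ ℓ)) (to Φ x ∈ U)
        ; resp   = λ { {p} {q} p≈q (lift p∈) →
            lift (Subset.resp U (Func.cong (actionFunc G T) {p} {q} p≈q) p∈) }
        }

      V-open : Topology.Open (productTopology (autTopology G T 𝒲 invariant) T) V
      V-open Φ x (lift Φx∈U) with A , A∈𝒲 , Φx∈A , A⊆U ← proj₂ basis U open-U (to Φ x) Φx∈U =
        coset (Φ⁻¹A ∷ []) Φ , proj₁ Φ⁻¹A
        , coset-open (Φ⁻¹A ∷ []) Φ , proj₁ basis (proj₁ Φ⁻¹A) (proj₂ Φ⁻¹A)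
        , ∈-coset (Φ⁻¹A ∷ []) Φ , (to Φ x , Φx∈A , strictlyInverseʳ Φ x)
        , λ where
            -- Here Ψ y lies in Ψ(Φ⁻¹(A)) ⊆ Φ(Φ⁻¹(A)) ⊆ A ⊆ U.
            Ψ y ((ΨΦ⁻¹A⊆ΦΦ⁻¹A , _) ∷ []) y∈Φ⁻¹A →
              lift (A⊆U _ (proj₁ (Inverse.strictlyInverseˡ (Func.to ι Φ) (A , A∈𝒲)) _
                (ΨΦ⁻¹A⊆ΦΦ⁻¹A (to Ψ y) (y , y∈Φ⁻¹A , refl))))
        where
        Φ⁻¹A = Inverse.from (Func.to ι Φ) (A , A∈𝒲)

mainTheorem5 :
    (∀ {ℓ} → ExcludedMiddle ℓ) →
    ∀ {c ℓ} (G : Group c ℓ) (T : Topology (Group.setoid G) (lsuc (c ⊔ ℓ))) →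
    IsPolishGroup G T →
    (𝒲 : Subset (𝒫 (Group.setoid G)) (lsuc (c ⊔ ℓ))) →
    Countable 𝒲 →
    IsBasis T 𝒲 →
    (invariant : IsInvariant G T 𝒲) →
    Topology.Closed (pointwiseTopology (subsetoid (𝒫 (Group.setoid G)) 𝒲)) (range G T 𝒲 invariant) →
    IsGroupMonomorphism (Group.rawGroup (Aut G T)) (Group.rawGroup (Sym (subsetoid (𝒫 (Group.setoid G)) 𝒲))) (imageInverse G T 𝒲 invariant)
    × StabilisersFormOpenBasisAtIdentity G T 𝒲 invariant
    × IsPolishGroup (Aut G T) (autTopology G T 𝒲 invariant)
    × Continuous (productTopology (autTopology G T 𝒲 invariant) T) T (actionFunc G T)
mainTheorem5 em G T (_ , _ , metrizable) 𝒲 countable basis invariant closed =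
    ι-isMonomorphism
  , ((λ As → stab-isSubgroup As , stab-open As) , stab-basis)
  , isPolishGroup closed
  , action-continuous
  where
  open Classical em
  open AutomorphismAction G T 𝒲 metrizable countable basis invariant
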